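{- Let $\mathbf{x}\in\{0,1\}^\omega$ be a one-sided infinite binary word beginning with $01$. Then $\mathbf{x}$ is good if and only if $\mathbf{x}=01\bullet\mathbf{f}$ for some $\mathbf{f}\in F$.
   Context: A factor of a word is a finite contiguous subword. A word $w$ encounters a pattern $p\in\{0,1\}^*$ if $g(p)$ is a factor of $w$ for some non-erasing morphism $g:\{0,1\}^*\to\{0,1\}^*$ (i.e. $g(0),g(1)$ non-empty). A (finite or one-sided infinite) binary word is good if it contains neither $11$ nor $1001$ as a factor, and encounters neither of the patterns $0000$ and $00010100$. Let $\delta$ be the morphism with $\delta(0)=01$, $\delta(1)=00$. Operators. Suppose a finite binary word $w$ has a suffix $\delta^n(01)$ for some $n\ge 0$; let $n$ be as large as possible and write $w=y\,\delta^n(01)$. Define $\alpha(w)=w\,\delta^n(00)=y\,\delta^{n+1}(01)$, $\beta(w)=w\,\delta^n(0100)=y\,\delta^{n+1}(001)$, $\gamma(w)=w\,\delta^n(010100)=y\,\delta^{n+1}(0001)$. Let $B=\{\alpha,\beta,\gamma\}$. For $\mathbf{f}=f_1f_2f_3\cdots\in B^\omega$ and such a $w$, the word $w$ is a proper prefix of $f_1(w)$, which is a proper prefix of $f_2(f_1(w))$, and so on; $w\bullet\mathbf{f}$ denotes the one-sided infinite word having all of $f_n(f_{n-1}(\cdots f_1(w)\cdots))$, $n\ge1$, as prefixes. The set $F$. Let $A_{01}$ be the automaton with states $a,b,c,d$, initial state $a$, and exactly the following labelled transitions: $a\xrightarrow{\alpha}a$, $a\xrightarrow{\beta}b$, $a\xrightarrow{\gamma}c$;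 $b\xrightarrow{\beta}b$, $b\xrightarrow{\alpha}d$, $b\xrightarrow{\gamma}c$; $c\xrightarrow{\gamma}c$, $c\xrightarrow{\alpha}d$; $d\xrightarrow{\alpha}b$, $d\xrightarrow{\beta}c$. Let $F\subseteq B^\omega$ be the set of label sequences of infinite paths in $A_{01}$ starting at $a$. -}

module Defs where

open import Data.Fin using (Fin)
open import Data.Fin.Patterns using (0F; 1F)
open import Data.List using (List; []; _∷_; _++_; length; concatMap; applyUpTo)
open import Data.Nat using (ℕ; zero; suc; _+_; _≤_)
open import Data.Product using (_×_; ∃; ∃-syntax)
open import Relation.Binary.PropositionalEquality using (_≡_; _≢_)
open import Relation.Nullary using (¬_)

Letter : Set
Letter = Fin 2

Word : Set
Word = List Letter

InfWord : Set
InfWord = ℕ → Letter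

infix 4 _isFactorOf_ _isPrefixOf_ _isSuffixOf_

_isFactorOf_ : Word → InfWord → Set
u isFactorOf x = ∃[ i ] applyUpTo (λ j → x (i + j)) (length u) ≡ u

_isPrefixOf_ : Word → InfWord → Set
u isPrefixOf x = applyUpTo x (length u) ≡ u

_isSuffixOf_ : Word → Word → Set
s isSuffixOf w = ∃[ y ] w ≡ y ++ s

-- A morphism of {0,1}* is given by its values on the two letters;
-- `concatMap g` is its action on words.
NonErasing : (Letter → Word) → Set
NonErasing g = ∀ a → g a ≢ []

Encounters : InfWord → Word → Set
Encounters x p = ∃[ g ] NonErasing g × concatMap g p isFactorOf x

record Good (x : InfWord) : Set where
  field
    no-11              : ¬ (1F ∷ 1F ∷ []) isFactorOf x
    no-1001            : ¬ (1F ∷ 0F ∷ 0F ∷ 1F ∷ []) isFactorOf x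
    avoids-0000        : ¬ Encounters x (0F ∷ 0F ∷ 0F ∷ 0F ∷ [])
    avoids-00010100    : ¬ Encounters x (0F ∷ 0F ∷ 0F ∷ 1F ∷ 0F ∷ 1F ∷ 0F ∷ 0F ∷ [])

δ : Letter → Word
δ 0F = 0F ∷ 1F ∷ []
δ 1F = 0F ∷ 0F ∷ []

δ^ : ℕ → Word → Word
δ^ zero    w = w
δ^ (suc n) w = concatMap δ (δ^ n w)

w01 : Word
w01 = 0F ∷ 1F ∷ []

MaxLevel : Word → ℕ → Set
MaxLevel w n = δ^ n w01 isSuffixOf w × (∀ m → δ^ m w01 isSuffixOf w → m ≤ n)

data Op : Set where
  α β γ : Op

ext : Op → Word
ext α = 0F ∷ 0F ∷ []
ext β = 0F ∷ 1F ∷ 0F ∷ 0F ∷ []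
ext γ = 0F ∷ 1F ∷ 0F ∷ 1F ∷ 0F ∷ 0F ∷ []

infix 4 _⟨_⟩≡_

-- The operators are partial functions on words (defined where some δⁿ(01) is
-- a suffix), so they are given by their graphs: o ⟨ w ⟩≡ w′ says that o(w) is
-- defined and equal to w′.
_⟨_⟩≡_ : Op → Word → Word → Set
o ⟨ w ⟩≡ w′ = ∃[ n ] MaxLevel w n × w′ ≡ w ++ δ^ n (ext o)

infix 4 _≐_•_

-- x ≐ w • f says that w • f is defined and equal to x: with f indexed from 0,
-- W n is fₙ₋₁(⋯f₀(w)⋯).
record _≐_•_ (x : InfWord) (w : Word) (f : ℕ → Op) : Set where
  field
    W        : ℕ → Word
    start    : W 0 ≡ w
    step     : ∀ n → f n ⟨ W n ⟩≡ W (suc n)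
    prefixes : ∀ n → W (suc n) isPrefixOf x

data State : Set where
  a b c d : State

infix 4 _─[_]→_

data _─[_]→_ : State → Op → State → Set where
  aαa : a ─[ α ]→ a
  aβb : a ─[ β ]→ b
  aγc : a ─[ γ ]→ c
  bβb : b ─[ β ]→ b
  bαd : b ─[ α ]→ d
  bγc : b ─[ γ ]→ c
  cγc : c ─[ γ ]→ c
  cαd : c ─[ α ]→ d
  dαb : d ─[ α ]→ b
  dβc : d ─[ β ]→ c

F : (ℕ → Op) → Set
F f = ∃ λ (q : ℕ → State) → q 0 ≡ a × (∀ n → q n ─[ f n ]→ q (suc n))

{-# OPTIONS --safe #-}
-- Write δω for the action of δ on infinite words. Along any sequence
-- of operators starting from 01 the maximal level grows by exactly one per step,
-- so x = 01 • f means x = δω (0ᵉ x₁) with x₁ = 01 • f′, where f′ is f without its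
-- first operator and e = 0, 1, 2 for α, β, γ.
--
-- In a good word consecutive 1s are at distance 2 or 4, so a good word starting
-- with 01 is δω (0ᵉ x₁) with e ≤ 2 and x₁ starting with 01; moreover δω y is good
-- iff y is. The state reached records which of x₁, 0x₁, 00x₁, 1x₁ must be good,
-- and prefixing one letter to δω y amounts, up to a shift of the occurrence by
-- one, to prefixing one letter to y. This gives the path in the automaton.
--
-- Conversely, the last index of a forbidden occurrence decreases along a path,
-- because desubstitution halves it; it is thereby pushed into the first four
-- letters, where nothing forbidden fits.
module Submission where

open import Defs
open import Data.Empty using (⊥; ⊥-elim)
open import Data.Fin.Patterns using (0F; 1F)
open import Data.List using ([]; _∷_; _++_; length; concatMap; applyUpTo)
open import Data.List.Properties using (++-assoc; length-++; concatMap-++; ∷-injective; ∷-injectiveˡ; ∷-injectiveʳ; ∷ʳ-injectiveʳ)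
open import Data.Nat using (ℕ; zero; suc; _+_; _*_; _^_; _≤_; _<_; z≤n; s≤s; z<s; s<s; s≤s⁻¹)
open import Data.Nat.Properties
open import Data.Nat.Tactic.RingSolver using (solve-∀)
open import Data.Product using (_×_; _,_; ∃-syntax; proj₁; proj₂)
open import Data.Sum using (_⊎_; inj₁; inj₂; [_,_]′)
open import Function using (_∘_)
open import Function.Bundles using (_⇔_; mk⇔)
open import Relation.Binary.Definitions using (tri<; tri≈; tri>)
open import Relation.Binary.PropositionalEquality using (_≡_; _≢_; _≗_; refl; sym; trans; cong; cong₂; subst; module ≡-Reasoning)
open import Relation.Nullary using (¬_)

-- Infinite words and the action of δ on them

comp : Letter → Letter
comp 0F = 1F
comp 1F = 0F

comp-involutive : ∀ l → comp (comp l) ≡ l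
comp-involutive 0F = refl
comp-involutive 1F = refl

0≢1 : ∀ {l : Letter} → l ≡ 0F → l ≡ 1F → ⊥
0≢1 refl ()

infixr 5 _◂_ _▹_

_◂_ : Letter → InfWord → InfWord
(l ◂ x) zero    = l
(l ◂ x) (suc n) = x n

_▹_ : Word → InfWord → InfWord
[]      ▹ x = x
(l ∷ u) ▹ x = l ◂ (u ▹ x)

drop : ℕ → InfWord → InfWord
drop i x j = x (i + j)

δω : InfWord → InfWord
δω x 0             = 0F
δω x 1             = comp (x 0)
δω x (suc (suc n)) = δω (x ∘ suc) n

◂-cong : ∀ l {x y} → x ≗ y → l ◂ x ≗ l ◂ y
◂-cong l eq zero    = refl
◂-cong l eq (suc n) = eq n

▹-cong : ∀ u {x y} → x ≗ y → u ▹ x ≗ u ▹ y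
▹-cong []      eq = eq
▹-cong (l ∷ u) eq = ◂-cong l (▹-cong u eq)

-- The second letter at index 2n is 0 whatever the argument, so agreement on n
-- letters already gives agreement on 2n + 1 letters of the images.
δω-local : ∀ n {x y} → (∀ t → t < n → x t ≡ y t) → ∀ t → t ≤ n * 2 → δω x t ≡ δω y t
δω-local n       eq 0             _ = refl
δω-local (suc n) eq 1             _ = cong comp (eq 0 z<s)
δω-local (suc n) eq (suc (suc t)) h = δω-local n (λ i i<n → eq (suc i) (s<s i<n)) t (s≤s⁻¹ (s≤s⁻¹ h))

δω-cong : ∀ {x y} → x ≗ y → δω x ≗ δω y
δω-cong eq t = δω-local t (λ i _ → eq i) t (m≤m*n t 2)

δω-even : ∀ x k → δω x (k * 2) ≡ 0F
δω-even x zero    = refl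
δω-even x (suc k) = δω-even (x ∘ suc) k

δω-odd : ∀ x k → δω x (suc (k * 2)) ≡ comp (x k)
δω-odd x zero    = refl
δω-odd x (suc k) = δω-odd (x ∘ suc) k

δω-drop : ∀ x i j → δω x (i * 2 + j) ≡ δω (drop i x) j
δω-drop x zero    j = refl
δω-drop x (suc i) j = δω-drop (x ∘ suc) i j

δω-◂ : ∀ l x → δω (l ◂ x) ≗ 0F ◂ comp l ◂ δω x
δω-◂ l x 0             = refl
δω-◂ l x 1             = refl
δω-◂ l x (suc (suc n)) = refl

δ⁻¹ω : InfWord → InfWord
δ⁻¹ω x k = comp (x (suc (k * 2)))

δω-δ⁻¹ω : ∀ {x} → (∀ k → x (k * 2) ≡ 0F) → x ≗ δω (δ⁻¹ω x)
δω-δ⁻¹ω         even 0             = even 0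
δω-δ⁻¹ω {x}     even 1             = sym (comp-involutive (x 1))
δω-δ⁻¹ω {x}     even (suc (suc n)) = δω-δ⁻¹ω {x ∘ suc ∘ suc} (even ∘ suc) n

data Parity : ℕ → Set where
  even : ∀ k → Parity (k * 2)
  odd  : ∀ k → Parity (suc (k * 2))

parity : ∀ n → Parity n
parity zero = even 0
parity (suc n) with parity n
... | even k = odd k
... | odd k  = even (suc k)

-- Of two indices at odd distance one is even, and there the image of δ has a 0.
δω-opposite : ∀ x m k {l} → δω x m ≡ l → δω x (m + suc (k * 2)) ≡ l → l ≡ 0F
δω-opposite x m k p q with parity m
... | even j = trans (sym p) (δω-even x j)
... | odd j  = trans (sym q) (trans (cong (δω x) (arith j k)) (δω-even x (suc (j + k))))
  where
  arith : ∀ j k → suc (j * 2) + suc (k * 2) ≡ suc (j + k) * 2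
  arith = solve-∀

-- Occurrences and their images under δ

-- Occ x U len i p e: the word obtained from p by substituting for each letter
-- l the word U l 0 ⋯ U l (len l - 1) occurs in x at index i and ends at an
-- index ≤ e.
Occ : InfWord → (Letter → ℕ → Letter) → (Letter → ℕ) → ℕ → Word → ℕ → Set
Occ x U len i []      e = i ≤ e
Occ x U len i (l ∷ p) e = (∀ t → t < len l → x (t + i) ≡ U l t) × Occ x U len (len l + i) p e

Literal : InfWord → ℕ → Word → ℕ → Set
Literal x i []      e = i ≤ e
Literal x i (l ∷ w) e = x i ≡ l × Literal x (suc i) w e

Occurs : InfWord → Word → ℕ → ℕ → Set
Occurs x p i e = ∃[ U ] ∃[ len ] ((∀ l → 0 < len l) × Occ x U len i p e)

pattern p11       = 1F ∷ 1F ∷ []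
pattern p1001     = 1F ∷ 0F ∷ 0F ∷ 1F ∷ []
pattern p0000     = 0F ∷ 0F ∷ 0F ∷ 0F ∷ []
pattern p00010100 = 0F ∷ 0F ∷ 0F ∷ 1F ∷ 0F ∷ 1F ∷ 0F ∷ 0F ∷ []

data ForbiddenFactor : Word → Set where
  f11   : ForbiddenFactor p11
  f1001 : ForbiddenFactor p1001

data ForbiddenPattern : Word → Set where
  f0000     : ForbiddenPattern p0000
  f00010100 : ForbiddenPattern p00010100

-- The end bound `e` turns non-goodness into a measure: substitution doubles it, desubstitution
-- halves it.
data Bad (x : InfWord) (e : ℕ) : Set where
  factor  : ∀ {w} → ForbiddenFactor w → ∀ i → Literal x i w e → Bad x e
  encounter : ∀ {p} → ForbiddenPattern p → ∀ i → Occurs x p i e → Bad x e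

literal-occurs : ∀ x w {i e} → Literal x i w e → Occurs x w i e
literal-occurs x w h = (λ l _ → l) , (λ _ → 1) , (λ _ → z<s) , go w h
  where
  go : ∀ w {i e} → Literal x i w e → Occ x (λ l _ → l) (λ _ → 1) i w e
  go []      h       = h
  go (l ∷ w) (q , h) = (λ { zero _ → q ; (suc _) (s≤s ()) }) , go w h

Literal-end : ∀ {x} w {i e} → Literal x i w e → i ≤ e
Literal-end []      h       = h
Literal-end (l ∷ w) (_ , h) = ≤-trans (n≤1+n _) (Literal-end w h)

Occ-end : ∀ x U len p {i e} → Occ x U len i p e → i ≤ e
Occ-end x U len []      h       = h
Occ-end x U len (l ∷ p) (_ , h) = ≤-trans (m≤n+m _ _) (Occ-end x U len p h)

Literal-map : ∀ {x y} s {e e′} → (∀ n → x n ≡ y (s + n)) → (∀ i → i ≤ e → s + i ≤ e′) →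
              ∀ w {i} → Literal x i w e → Literal y (s + i) w e′
Literal-map s eq le []      h       = le _ h
Literal-map {y = y} s {e′ = e′} eq le (l ∷ w) {i} (q , h) =
  trans (sym (eq i)) q ,
  subst (λ j → Literal y j w e′) (+-suc s i) (Literal-map s eq le w h)

Occ-map : ∀ {x y U len} s {e e′} → (∀ n → x n ≡ y (s + n)) → (∀ i → i ≤ e → s + i ≤ e′) →
          ∀ p {i} → Occ x U len i p e → Occ y U len (s + i) p e′
Occ-map s eq le []      h = le _ h
Occ-map {y = y} {U} {len} s {e′ = e′} eq le (l ∷ p) {i} (q , h) =
  (λ t t< → trans (cong y (swap t s i)) (trans (sym (eq (t + i))) (q t t<))) ,
  subst (λ j → Occ y U len j p e′) (swap′ s (len l) i) (Occ-map s eq le p h)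
  where
  swap : ∀ t s i → t + (s + i) ≡ s + (t + i)
  swap = solve-∀
  swap′ : ∀ s n i → s + (n + i) ≡ n + (s + i)
  swap′ = solve-∀

-- The shift `s` and the free change of bound make pointwise equality, weakening of the bound,
-- prefixing a letter and dropping a prefix instances of one lemma.
Bad-map : ∀ {x y} s {e e′} → (∀ n → x n ≡ y (s + n)) → (∀ i → i ≤ e → s + i ≤ e′) →
          Bad x e → Bad y e′
Bad-map s eq le (factor f i h)                   = factor f (s + i) (Literal-map s eq le _ h)
Bad-map s eq le (encounter f i (U , len , pos , h)) = encounter f (s + i) (U , len , pos , Occ-map s eq le _ h)

Bad-cong : ∀ {x y e} → x ≗ y → Bad x e → Bad y e
Bad-cong eq = Bad-map 0 eq (λ _ h → h)

Bad-mono : ∀ {x e e′} → e ≤ e′ → Bad x e → Bad x e′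
Bad-mono e≤e′ = Bad-map 0 (λ _ → refl) (λ _ h → ≤-trans h e≤e′)

Bad-◂ : ∀ l {x e} → Bad x e → Bad (l ◂ x) (suc e)
Bad-◂ l = Bad-map 1 (λ _ → refl) (λ _ → s≤s)

Literal-tail : ∀ {l x e} w {i} → Literal (l ◂ x) (suc i) w (suc e) → Literal x i w e
Literal-tail []      h       = s≤s⁻¹ h
Literal-tail (_ ∷ w) (q , h) = q , Literal-tail w h

Occ-tail : ∀ {l x U len e} p {i} → Occ (l ◂ x) U len (suc i) p (suc e) → Occ x U len i p e
Occ-tail []      h       = s≤s⁻¹ h
Occ-tail {l} {x} {U} {len} {e} (k ∷ p) {i} (q , h) =
  (λ t t< → trans (sym (cong (l ◂ x) (+-suc t i))) (q t t<)) ,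
  Occ-tail p (subst (λ j → Occ (l ◂ x) U len j p (suc e)) (+-suc (len k) i) h)

Literal-δ : ∀ x w {i e} → Literal x i w e → Literal (δω x) (i * 2) (concatMap δ w) (e * 2)
Literal-δ x []       h       = *-monoˡ-≤ 2 h
Literal-δ x (0F ∷ w) {i} (q , h) = δω-even x i , trans (δω-odd x i) (cong comp q) , Literal-δ x w h
Literal-δ x (1F ∷ w) {i} (q , h) = δω-even x i , trans (δω-odd x i) (cong comp q) , Literal-δ x w h

-- With s = 1 this is the occurrence read from the second letter of its first
-- block up to the first letter after its last block.
Occ-δ : ∀ {x U len e} s → s ≤ 1 → ∀ p {i} → Occ x U len i p e →
        Occ (δω x) (λ l t → δω (U l) (s + t)) (λ l → len l * 2) (s + i * 2) p (s + e * 2)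
Occ-δ s s≤1 [] h = +-monoʳ-≤ s (*-monoˡ-≤ 2 h)
Occ-δ {x} {U} {len} {e} s s≤1 (l ∷ p) {i} (q , h) =
  block , subst (λ j → Occ (δω x) (λ k t → δω (U k) (s + t)) (λ k → len k * 2) j p (s + e * 2))
    (arith′ s (len l) i) (Occ-δ s s≤1 p h)
  where
  arith : ∀ t s i → t + (s + i * 2) ≡ i * 2 + (s + t)
  arith = solve-∀
  arith′ : ∀ s n i → s + (n + i) * 2 ≡ n * 2 + (s + i * 2)
  arith′ = solve-∀
  block : ∀ t → t < len l * 2 → δω x (t + (s + i * 2)) ≡ δω (U l) (s + t)
  block t t< = trans (cong (δω x) (arith t s i)) (trans (δω-drop x i (s + t))
    (δω-local (len l) (λ j j< → trans (cong x (+-comm i j)) (q j j<)) (s + t)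
      (≤-trans (+-monoˡ-≤ t s≤1) t<)))

Occurs-δ : ∀ {x e} s → s ≤ 1 → ∀ {p i} → Occurs x p i e → Occurs (δω x) p (s + i * 2) (s + e * 2)
Occurs-δ s s≤1 {p} (U , len , pos , h) =
  _ , _ , (λ l → ≤-trans (s≤s z≤n) (*-monoˡ-≤ 2 (pos l))) , Occ-δ s s≤1 p h

-- δ(11) = 0000 and δ(1001) = 00010100, so each forbidden factor becomes a forbidden pattern, read
-- with the identity morphism.
Bad-δ : ∀ {x e} → Bad x e → Bad (δω x) (e * 2)
Bad-δ {x} (factor f11 i h)   = encounter f0000 (i * 2) (literal-occurs (δω x) _ (Literal-δ x p11 h))
Bad-δ {x} (factor f1001 i h) = encounter f00010100 (i * 2) (literal-occurs (δω x) _ (Literal-δ x p1001 h))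
Bad-δ (encounter f i o)    = encounter f (i * 2) (Occurs-δ 0 z≤n o)

-- A pattern occurrence in δω (l ◂ x) starting at index 0 may be shifted by one.
Bad-shift : ∀ l {x e} → (∀ {w} → ForbiddenFactor w → ¬ Literal (l ◂ x) 0 w e) →
            Bad (l ◂ x) e → Bad (comp l ◂ δω x) (e * 2)
Bad-shift l no (factor f zero h) = ⊥-elim (no f h)
Bad-shift l {e = suc e} no (factor f (suc i) h) =
  Bad-mono (n≤1+n _) (Bad-◂ (comp l) (Bad-δ (factor f i (Literal-tail _ h))))
Bad-shift l {e = zero} no (factor f (suc i) h) with () ← Literal-end _ h
Bad-shift l {x} {e} no (encounter f i o) with U , len , pos , h ← Occurs-δ 1 ≤-refl o =
  encounter f (i * 2) (U , len , pos ,
    Occ-tail {0F} _ (Occ-map 0 (δω-◂ l x) (λ _ h → h) _ h))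

-- Desubstitution

-- With all block lengths even, every copy starts at the parity of `i`. The offset `s` leads to the
-- first odd index, and the letters at odd indices determine the preimage.
Occ-δ⁻¹ : ∀ x U len len′ {e e′} s → s ≤ 1 → (∀ l → len l ≡ len′ l * 2) → e ≤ e′ * 2 →
          ∀ p {i j} → s + i ≡ suc (j * 2) → Occ (δω x) U len i p e →
          Occ x (λ l t → comp (U l (s + t * 2))) len′ j p e′
Occ-δ⁻¹ x U len len′ {e} {e′} s s≤1 lens e≤ [] {i} {j} at h = *-cancelʳ-≤ j e′ 2 (begin
  j * 2     ≤⟨ s≤s⁻¹ (≤-trans (≤-reflexive (sym at)) (+-monoˡ-≤ i s≤1)) ⟩
  i         ≤⟨ h ⟩
  e         ≤⟨ e≤ ⟩
  e′ * 2    ∎)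
  where open ≤-Reasoning
Occ-δ⁻¹ x U len len′ s s≤1 lens e≤ (l ∷ p) {i} {j} at (q , h) =
  block , Occ-δ⁻¹ x U len len′ s s≤1 lens e≤ p next h
  where
  open ≡-Reasoning
  arith₁ : ∀ s t i → s + t * 2 + i ≡ t * 2 + (s + i)
  arith₁ = solve-∀
  arith₂ : ∀ t j → t * 2 + suc (j * 2) ≡ suc ((t + j) * 2)
  arith₂ = solve-∀
  arith₃ : ∀ s n i → s + (n * 2 + i) ≡ n * 2 + (s + i)
  arith₃ = solve-∀
  block : ∀ t → t < len′ l → x (t + j) ≡ comp (U l (s + t * 2))
  block t t< = sym (begin
    comp (U l (s + t * 2))              ≡⟨ cong comp (q (s + t * 2) inside) ⟨
    comp (δω x (s + t * 2 + i))         ≡⟨ cong (comp ∘ δω x) (trans (arith₁ s t i) (cong (t * 2 +_) at)) ⟩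
    comp (δω x (t * 2 + suc (j * 2)))   ≡⟨ cong (comp ∘ δω x) (arith₂ t j) ⟩
    comp (δω x (suc ((t + j) * 2)))     ≡⟨ cong comp (δω-odd x (t + j)) ⟩
    comp (comp (x (t + j)))             ≡⟨ comp-involutive _ ⟩
    x (t + j)                           ∎)
    where
    inside : s + t * 2 < len l
    inside = subst (s + t * 2 <_) (sym (lens l)) (≤-trans (s≤s (+-monoˡ-≤ (t * 2) s≤1)) (*-monoˡ-≤ 2 t<))
  next : s + (len l + i) ≡ suc ((len′ l + j) * 2)
  next = begin
    s + (len l + i)              ≡⟨ cong (λ n → s + (n + i)) (lens l) ⟩
    s + (len′ l * 2 + i)         ≡⟨ arith₃ s (len′ l) i ⟩
    len′ l * 2 + (s + i)         ≡⟨ cong (len′ l * 2 +_) at ⟩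
    len′ l * 2 + suc (j * 2)     ≡⟨ arith₂ (len′ l) j ⟩
    suc ((len′ l + j) * 2)       ∎

ZeroRun : InfWord → ℕ → ℕ → Set
ZeroRun x i n = ∀ t → t < n → x (t + i) ≡ 0F

ZeroRun-++ : ∀ {x} m {n i} → ZeroRun x i m → ZeroRun x (m + i) n → ZeroRun x i (m + n)
ZeroRun-++ zero r r′ = r′
ZeroRun-++ (suc m) r r′ zero _ = r zero z<s
ZeroRun-++ {x} (suc m) {n} {i} r r′ (suc t) t< =
  trans (cong x (sym (+-suc t i)))
    (ZeroRun-++ {x} m {n} {suc i}
      (λ u u< → trans (cong x (+-suc u i)) (r (suc u) (s<s u<)))
      (λ u u< → trans (cong (λ k → x (u + k)) (+-suc m i)) (r′ u u<))
      t (s≤s⁻¹ t<))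

Has11 : InfWord → ℕ → Set
Has11 x e = ∃[ i ] Literal x i p11 e

-- An occurrence of 1AA1 at index i, where A has length k + 1.
Has1AA1 : InfWord → ℕ → ℕ → Set
Has1AA1 x i e = ∃[ k ] (x i ≡ 1F
                     × (∀ t → t ≤ k → x (suc t + i) ≡ x (suc t + (suc k + i)))
                     × x (suc (suc k + (suc k + i))) ≡ 1F
                     × suc (suc (suc k + (suc k + i))) ≤ e)

δω-zero⇒one : ∀ x k → δω x (suc (k * 2)) ≡ 0F → x k ≡ 1F
δω-zero⇒one x k q = trans (sym (comp-involutive (x k))) (cong comp (trans (sym (δω-odd x k)) q))

δω-zeros⇒11 : ∀ {x k e e′} → δω x (suc (k * 2)) ≡ 0F → δω x (suc (suc k * 2)) ≡ 0F →
              suc k * 2 < e → e ≤ e′ * 2 → Has11 x e′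
δω-zeros⇒11 {x} {k} {e} {e′} p q h e≤ =
  k , δω-zero⇒one x k p , δω-zero⇒one x (suc k) q ,
  *-cancelʳ-< 2 (suc k) e′ (<-≤-trans h e≤)

-- Two of four consecutive indices are odd, and zeros there come from adjacent 1s.
δω-0000⇒11 : ∀ {x} i {e e′} → ZeroRun (δω x) i 4 → 4 + i ≤ e → e ≤ e′ * 2 → Has11 x e′
δω-0000⇒11 {x} i r h e≤ with parity i
... | even k = δω-zeros⇒11 {x} {k} (r 1 (s≤s (s≤s z≤n))) (r 3 ≤-refl) (≤-trans (n≤1+n _) h) e≤
... | odd k  = δω-zeros⇒11 {x} {k} (r 0 z<s) (r 2 (s≤s (s≤s (s≤s z≤n)))) (≤-trans (≤-trans (n≤1+n _) (n≤1+n _)) h) e≤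

by-letter : ∀ {A : Set} → A → A → Letter → A
by-letter m n 0F = m
by-letter m n 1F = n

-- The condition `s ≡ 1` restricts 1AA1 to occurrences starting at an even index; `Bad-0δ0⁻¹`, which
-- desubstitutes from an odd index, can thus discard it.
Desubstituted : InfWord → Word → ℕ → ℕ → ℕ → Set
Desubstituted x p s j e = Occurs x p j e ⊎ Has11 x e ⊎ s ≡ 1 × Has1AA1 x j e

-- If |u| is odd, consecutive copies of u start at opposite parities, so u consists of zeros and the
-- four copies contain 0000. If |u| is even, the occurrence itself descends.
desubstitute-0000 : ∀ {x s i j e e′} → s ≤ 1 → s + i ≡ suc (j * 2) → e ≤ e′ * 2 →
  ∀ n u → 0 < n → Occ (δω x) (λ _ → u) (λ _ → n) i p0000 e → Desubstituted x p0000 s j e′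
desubstitute-0000 {x} {s} {i} s≤1 at e≤ n u pos o@(b₁ , b₂ , b₃ , b₄ , end) with parity n
... | even k = inj₁ ((λ _ t → comp (u (s + t * 2))) , (λ _ → k) , (λ _ → *-cancelʳ-< 2 0 k pos) ,
                     Occ-δ⁻¹ x (λ _ → u) (λ _ → k * 2) (λ _ → k) s s≤1 (λ _ → refl) e≤ p0000 at o)
... | odd k  = inj₂ (inj₁ (δω-0000⇒11 {x} i
                 (λ t t< → ZeroRun-++ {δω x} n (run b₁) (ZeroRun-++ {δω x} n (run b₂)
                   (ZeroRun-++ {δω x} n (run b₃) (run b₄))) t (≤-trans t< four))
                 (≤-trans (+-monoˡ-≤ i four) (≤-trans (≤-reflexive (assoc n i)) end)) e≤))
  where
  arith : ∀ t n i → t + (n + i) ≡ (t + i) + n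
  arith = solve-∀
  assoc : ∀ n i → n + (n + (n + n)) + i ≡ n + (n + (n + (n + i)))
  assoc = solve-∀
  four : 4 ≤ n + (n + (n + n))
  four = +-mono-≤ pos (+-mono-≤ pos (+-mono-≤ pos pos))
  zeros : ∀ t → t < n → u t ≡ 0F
  zeros t t< = δω-opposite x (t + i) k (b₁ t t<) (trans (cong (δω x) (sym (arith t n i))) (b₂ t t<))
  run : ∀ {m} → (∀ t → t < n → δω x (t + m) ≡ u t) → ZeroRun (δω x) m n
  run h t t< = trans (h t t<) (zeros t t<)

two-zero-blocks⇒11 : ∀ {x n} {u : ℕ → Letter} {i e e′} → 2 ≤ n → (∀ t → t < n → u t ≡ 0F) →
  (∀ t → t < n → δω x (t + i) ≡ u t) → (∀ t → t < n → δω x (t + (n + i)) ≡ u t) →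
  n + (n + i) ≤ e → e ≤ e′ * 2 → Has11 x e′
two-zero-blocks⇒11 {x} {n} {u} {i} 2≤n zeros b₁ b₂ end e≤ =
  δω-0000⇒11 {x} i
    (λ t t< → ZeroRun-++ {δω x} n (λ t t< → trans (b₁ t t<) (zeros t t<))
                                  (λ t t< → trans (b₂ t t<) (zeros t t<)) t (≤-trans t< (+-mono-≤ 2≤n 2≤n)))
    (≤-trans (+-monoˡ-≤ i (+-mono-≤ 2≤n 2≤n)) (≤-trans (≤-reflexive (+-assoc n n i)) end)) e≤

-- Parity of |u| and |v| decides: an occurrence of u, or of v, at indices of
-- opposite parity consists of zeros only, which leaves |u|, |v| both even, or
-- u = 0 and |v| odd. In the latter case 00(0v)(0v)00 is the image of 1AA1.
desubstitute-00010100 : ∀ {x s i j e e′} → s ≤ 1 → s + i ≡ suc (j * 2) → e ≤ e′ * 2 →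
  ∀ m n u v → 0 < m → 0 < n → Occ (δω x) (by-letter u v) (by-letter m n) i p00010100 e →
  Desubstituted x p00010100 s j e′
desubstitute-00010100 {x} {s} {i} {j} {e} {e′} s≤1 at e≤ m n u v m>0 n>0
  o@(b₁ , b₂ , b₃ , b₄ , b₅ , b₆ , b₇ , b₈ , end) with parity m
... | odd (suc k) = inj₂ (inj₁ (two-zero-blocks⇒11 {x} {u = u} (s≤s (s≤s z≤n)) zeros b₁ b₂
      (Occ-end (δω x) (by-letter u v) (by-letter m n) (0F ∷ 1F ∷ 0F ∷ 1F ∷ 0F ∷ 0F ∷ []) (b₃ , b₄ , b₅ , b₆ , b₇ , b₈ , end)) e≤))
  where
  arith : ∀ t n i → t + (n + i) ≡ (t + i) + n
  arith = solve-∀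
  zeros : ∀ t → t < m → u t ≡ 0F
  zeros t t< = δω-opposite x (t + i) (suc k) (b₁ t t<) (trans (cong (δω x) (sym (arith t m i))) (b₂ t t<))
... | even k with parity n
...   | even k′ = inj₁ ((λ l t → comp (by-letter u v l (s + t * 2))) , by-letter k k′ , pos′ ,
      Occ-δ⁻¹ x (by-letter u v) (by-letter m n) (by-letter k k′) s s≤1 lens e≤ p00010100 at o)
  where
  pos′ : ∀ l → 0 < by-letter k k′ l
  pos′ 0F = *-cancelʳ-< 2 0 k m>0
  pos′ 1F = *-cancelʳ-< 2 0 k′ n>0
  lens : ∀ l → by-letter (k * 2) (k′ * 2) l ≡ by-letter k k′ l * 2
  lens 0F = refl
  lens 1F = refl
-- The third and fourth copies of u are separated by v, hence lie at the odd distance |u| + |v|.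
...   | odd k′  = inj₂ (inj₁ (two-zero-blocks⇒11 {x} {u = u} 2≤m zeros b₁ b₂
      (Occ-end (δω x) (by-letter u v) (by-letter m n) (0F ∷ 1F ∷ 0F ∷ 1F ∷ 0F ∷ 0F ∷ []) (b₃ , b₄ , b₅ , b₆ , b₇ , b₈ , end)) e≤))
  where
  2≤m : 2 ≤ k * 2
  2≤m = *-monoˡ-≤ 2 (*-cancelʳ-< 2 0 k m>0)
  arith : ∀ t k k′ r → t + (suc (k′ * 2) + (k * 2 + r)) ≡ t + r + suc ((k + k′) * 2)
  arith = solve-∀
  zeros : ∀ t → t < m → u t ≡ 0F
  zeros t t< = δω-opposite x (t + (m + (m + i))) (k + k′) (b₃ t t<)
                 (trans (cong (δω x) (sym (arith t k k′ (m + (m + i))))) (b₅ t t<))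
desubstitute-00010100 {s = suc (suc _)} (s≤s ()) _ _ _ _ _ _ _ _ _ | odd zero
desubstitute-00010100 {x} {zero} {i} {j} {e} {e′} s≤1 refl e≤ m n u v m>0 n>0
  o@(b₁ , b₂ , b₃ , b₄ , b₅ , b₆ , b₇ , b₈ , end) | odd zero =
  inj₂ (inj₁ (δω-zeros⇒11 {x} {j} (trans (b₁ 0 z<s) u0) (trans (b₃ 0 z<s) u0) (≤-trans (n≤1+n _)
      (Occ-end (δω x) (by-letter u v) (by-letter m n) (1F ∷ 0F ∷ 1F ∷ 0F ∷ 0F ∷ []) (b₄ , b₅ , b₆ , b₇ , b₈ , end))) e≤))
  where
  u0 : u 0 ≡ 0F
  u0 = δω-opposite x i 0 (b₁ 0 z<s) (trans (cong (δω x) (+-comm i 1)) (b₂ 0 z<s))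
desubstitute-00010100 {x} {suc zero} {i} {j} {e} {e′} s≤1 refl e≤ m n u v m>0 n>0
  o@(b₁ , b₂ , b₃ , b₄ , b₅ , b₆ , b₇ , b₈ , end) | odd zero with parity n
-- The copies of v lie at the odd distance |v| + 1, so v begins with 0; this 0 and the second copy
-- of u = 0 stand at consecutive odd indices.
... | even k = inj₂ (inj₁ (δω-zeros⇒11 {x} {j} (trans (b₂ 0 z<s) u0) (trans (b₄ 0 n>0) v0)
      (≤-trans (m≤n+m (3 + j * 2) (suc (k * 2)))
      (Occ-end (δω x) (by-letter u v) (by-letter m n) (1F ∷ 0F ∷ 0F ∷ []) (b₆ , b₇ , b₈ , end))) e≤))
  where
  u0 : u 0 ≡ 0F
  u0 = δω-opposite x i 0 (b₁ 0 z<s) (trans (cong (δω x) (+-comm i 1)) (b₂ 0 z<s))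
  arith : ∀ n r → suc (n + r) ≡ r + suc n
  arith = solve-∀
  v0 : v 0 ≡ 0F
  v0 = δω-opposite x (3 + i) k (b₄ 0 n>0) (trans (cong (δω x) (sym (arith n (3 + i)))) (b₆ 0 n>0))
... | odd k  = inj₂ (inj₂ (refl , k , δω-zero⇒one x j (trans (b₂ 0 z<s) u0) , square ,
      δω-zero⇒one x _ (trans (cong (δω x) (sym (arith₃ k j))) (trans (b₈ 0 z<s) u0)) , bound))
  where
  u0 : u 0 ≡ 0F
  u0 = δω-opposite x i 0 (b₁ 0 z<s) (trans (cong (δω x) (+-comm i 1)) (b₂ 0 z<s))
  arith₁ : ∀ t j → t * 2 + (3 + j * 2) ≡ suc ((suc t + j) * 2)
  arith₁ = solve-∀
  arith₂ : ∀ t k j → t * 2 + suc (suc (k * 2) + (3 + j * 2)) ≡ suc ((suc t + (suc k + j)) * 2)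
  arith₂ = solve-∀
  arith₃ : ∀ k j → suc (suc (k * 2) + suc (suc (k * 2) + (3 + j * 2))) ≡ suc (suc (suc k + (suc k + j)) * 2)
  arith₃ = solve-∀
  value : ∀ t {r} → δω x (suc (r * 2)) ≡ v (t * 2) → x r ≡ comp (v (t * 2))
  value t {r} q = trans (sym (comp-involutive _)) (cong comp (trans (sym (δω-odd x r)) q))
  square : ∀ t → t ≤ k → x (suc t + j) ≡ x (suc t + (suc k + j))
  square t t≤ = trans (value t (trans (cong (δω x) (sym (arith₁ t j))) (b₄ (t * 2) (s≤s (*-monoˡ-≤ 2 t≤)))))
    (sym (value t (trans (cong (δω x) (sym (arith₂ t k j))) (b₆ (t * 2) (s≤s (*-monoˡ-≤ 2 t≤))))))
  bound : suc (suc (suc k + (suc k + j))) ≤ e′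
  bound = *-cancelʳ-≤ _ e′ 2 (≤-trans (≤-reflexive (cong suc (sym (arith₃ k j)))) (≤-trans end e≤))

-- If A begins or ends with 1, it forms 11 with a bordering 1. Otherwise A = 0 gives 1001 and A = 00
-- gives 0000. A longer A starting with 00 gives 1001 after the first 1, or starts with 000 and
-- forms 0000 with the end of the previous copy. If it starts with 01, then 1001 arises where the
-- copies meet, unless A ends with 00; in that case either 1001 arises before the last 1, or A ends
-- with 000 and the next copy completes 0000.
square⇒bad : ∀ x k → x 0 ≡ 1F → (∀ t → t ≤ k → x (suc t) ≡ x (suc (t + suc k))) →
             x (suc (suc k + suc k)) ≡ 1F → Bad x (2 + (suc k + suc k))
square⇒bad x k x0 sq last with x 1 in x1
... | 1F = factor f11 0 (x0 , x1 , s≤s (s≤s z≤n))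
... | 0F with x (suc k) in xk
...   | 1F = factor f11 (suc (k + suc k)) (trans (sym (sq k ≤-refl)) xk , last , ≤-refl)
...   | 0F = go k xk sq last
  where
  copy : ∀ {k l} t → (∀ t → t ≤ k → x (suc t) ≡ x (suc (t + suc k))) → t ≤ k →
         x (suc t) ≡ l → x (suc (t + suc k)) ≡ l
  copy t sq t≤ q = trans (sym (sq t t≤)) q
  go : ∀ k → x (suc k) ≡ 0F → (∀ t → t ≤ k → x (suc t) ≡ x (suc (t + suc k))) →
       x (suc (suc k + suc k)) ≡ 1F → Bad x (2 + (suc k + suc k))
  go 0 xk sq last = factor f1001 0 (x0 , x1 , copy 0 sq z≤n x1 , last , ≤-refl)
  go 1 xk sq last = encounter f0000 1 (literal-occurs x _
    (x1 , xk , copy 0 sq z≤n x1 , copy 1 sq ≤-refl xk , n≤1+n _))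
  go (suc (suc k)) xk sq last with x 2 in x2
  go (suc (suc k)) xk sq last | 0F with x 3 in x3
  ... | 1F = factor f1001 0 (x0 , x1 , x2 , x3 , s≤s (s≤s (s≤s (s≤s z≤n))))
  ... | 0F = encounter f0000 (3 + k) (literal-occurs x _
    (xk , copy 0 sq z≤n x1 , copy 1 sq (s≤s z≤n) x2 , copy 2 sq (s≤s (s≤s z≤n)) x3 ,
     ≤-trans (n≤1+n _) (+-monoʳ-≤ 5 (m≤n+m (3 + k) k))))
  go (suc (suc k)) xk sq last | 1F with x (2 + k) in xk-1
  ... | 1F = factor f1001 (2 + k)
    (xk-1 , xk , copy 0 sq z≤n x1 , copy 1 sq (s≤s z≤n) x2 ,
     ≤-trans (m≤n+m _ 2) (+-monoʳ-≤ 5 (m≤n+m (3 + k) k)))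
  ... | 0F with x (1 + k) in xk-2
  ...   | 1F = factor f1001 (suc (k + (3 + k)))
    (copy k sq (m≤n+m k 2) xk-2 , copy (1 + k) sq (n≤1+n _) xk-1 , copy (2 + k) sq ≤-refl xk , last , ≤-refl)
  ...   | 0F = encounter f0000 (1 + k) (literal-occurs x _
    (xk-2 , xk-1 , xk , copy 0 sq z≤n x1 , ≤-trans (m≤n+m _ 3) (+-monoʳ-≤ 5 (m≤n+m (3 + k) k))))

1AA1⇒bad : ∀ {x} i {e} → Has1AA1 x i e → Bad x e
1AA1⇒bad {x} i (k , xi , sq , last , end) = Bad-map i (λ n → cong x (+-comm n i))
  (λ j j≤ → ≤-trans (+-monoʳ-≤ i j≤) (≤-trans (≤-reflexive (arith i k)) end))
  (square⇒bad (λ n → x (n + i)) k xi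
    (λ t t≤ → trans (sq t t≤) (cong (x ∘ suc) (sym (+-assoc t (suc k) i))))
    (trans (cong (x ∘ suc) (+-assoc (suc k) (suc k) i)) last))
  where
  arith : ∀ i k → i + (2 + (suc k + suc k)) ≡ 2 + (suc k + (suc k + i))
  arith = solve-∀

desubstitute : ∀ {x p s i j e e′} → ForbiddenPattern p → s ≤ 1 → s + i ≡ suc (j * 2) → e ≤ e′ * 2 →
               Occurs (δω x) p i e → Desubstituted x p s j e′
desubstitute f0000 s≤1 at e≤ (U , len , pos , h) =
  desubstitute-0000 s≤1 at e≤ (len 0F) (U 0F) (pos 0F) h
desubstitute f00010100 s≤1 at e≤ (U , len , pos , h) =
  desubstitute-00010100 s≤1 at e≤ (len 0F) (len 1F) (U 0F) (U 1F) (pos 0F) (pos 1F) h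

-- The outer letters of 11 and of 1001 are 1s at odd distance, whereas images of δ have 1s at odd
-- indices only.
δω-no-factor : ∀ {x w i e} → ForbiddenFactor w → ¬ Literal (δω x) i w e
δω-no-factor {x} {i = i} f11 (q₀ , q₁ , _) with parity i
... | even k = 0≢1 (δω-even x k) q₀
... | odd k  = 0≢1 (δω-even x (suc k)) q₁
δω-no-factor {x} {i = i} f1001 (q₀ , _ , _ , q₃ , _) with parity i
... | even k = 0≢1 (δω-even x k) q₀
... | odd k  = 0≢1 (δω-even x (2 + k)) q₃

Bad-δ⁻¹ : ∀ {x e} e′ → e ≤ e′ * 2 → Bad (δω x) e → Bad x e′
Bad-δ⁻¹ {x} e′ e≤ (factor f i h) = ⊥-elim (δω-no-factor {x} f h)
Bad-δ⁻¹ {x} {e} e′ e≤ (encounter {p} f i o) = by-parity (parity i) o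
  where
  from : ∀ {s} j → Desubstituted x p s j e′ → Bad x e′
  from j (inj₁ o)              = encounter f j o
  from j (inj₂ (inj₁ (i , h))) = factor f11 i h
  from j (inj₂ (inj₂ (_ , h))) = 1AA1⇒bad j h
  by-parity : ∀ {i} → Parity i → Occurs (δω x) p i e → Bad x e′
  by-parity (even k) o = from k (desubstitute {x} {s = 1} f ≤-refl refl e≤ o)
  by-parity (odd k)  o = from k (desubstitute {x} {s = 0} f z≤n refl e≤ o)

-- A forbidden pattern occurrence at index 0 begins with a cube uuu, so the
-- prefix 1001 recurs at index |u|.
1001-recurs : ∀ {x p e} → x 0 ≡ 1F → x 1 ≡ 0F → x 2 ≡ 0F → x 3 ≡ 1F →
              ForbiddenPattern p → Occurs x p 0 e → ∃[ i ] Literal x (suc i) p1001 e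
1001-recurs {x} x0 x1 x2 x3 = from
  where
  cube : ∀ n {u : ℕ → Letter} {e} → 0 < n → (∀ t → t < n → x (t + 0) ≡ u t) →
         (∀ t → t < n → x (t + (n + 0)) ≡ u t) → (∀ t → t < n → x (t + (n + (n + 0))) ≡ u t) →
         n + (n + (n + 0)) ≤ e → ∃[ i ] Literal x (suc i) p1001 e
  cube 1 {u} _ b₁ b₂ b₃ end = ⊥-elim (0≢1 x1 (trans (b₂ 0 z<s) (trans (sym (b₁ 0 z<s)) x0)))
  cube 2 {u} _ b₁ b₂ b₃ end = ⊥-elim (0≢1 x2 (trans (b₂ 0 z<s) (trans (sym (b₁ 0 z<s)) x0)))
  cube 3 {u} _ b₁ b₂ b₃ end = 2 ,
    trans (b₂ 0 z<s) (trans (sym (b₁ 0 z<s)) x0) ,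
    trans (b₂ 1 (s≤s z<s)) (trans (sym (b₁ 1 (s≤s z<s))) x1) ,
    trans (b₂ 2 ≤-refl) (trans (sym (b₁ 2 ≤-refl)) x2) ,
    trans (b₃ 0 z<s) (trans (sym (b₁ 0 z<s)) x0) ,
    ≤-trans (m≤n+m _ 2) end
  cube n@(suc (suc (suc (suc m)))) {u} _ b₁ b₂ b₃ end = 3 + m + 0 ,
    again 0 z<s x0 , again 1 (s≤s z<s) x1 , again 2 (s≤s (s≤s z<s)) x2 , again 3 (s≤s (s≤s (s≤s z<s))) x3 ,
    ≤-trans (+-monoˡ-≤ (n + 0) {4} {n} (s≤s (s≤s (s≤s (s≤s z≤n))))) (≤-trans (m≤n+m _ n) end)
    where
    again : ∀ t {l} → t < n → x t ≡ l → x (t + (n + 0)) ≡ l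
    again t t< q = trans (b₂ t t<) (trans (sym (b₁ t t<)) (trans (cong x (+-identityʳ t)) q))
  from : ∀ {p e} → ForbiddenPattern p → Occurs x p 0 e → ∃[ i ] Literal x (suc i) p1001 e
  from f0000 (U , len , pos , b₁ , b₂ , b₃ , rest) =
    cube (len 0F) (pos 0F) b₁ b₂ b₃ (Occ-end x U len (0F ∷ []) rest)
  from f00010100 (U , len , pos , b₁ , b₂ , b₃ , rest) =
    cube (len 0F) (pos 0F) b₁ b₂ b₃ (Occ-end x U len (1F ∷ 0F ∷ 1F ∷ 0F ∷ 0F ∷ []) rest)

-- Transitions of the automaton

zeros : Op → Word
zeros α = []
zeros β = 0F ∷ []
zeros γ = 0F ∷ 0F ∷ []

≤-halves : ∀ m → ∃[ k ] (m ≤ k * 2 × k * 2 ≤ suc m)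
≤-halves m with parity m
... | even k = k , ≤-refl , n≤1+n _
... | odd k  = suc k , n≤1+n _ , ≤-refl

no-factor-at-0 : ∀ {x w e} → ForbiddenFactor w → ¬ Literal (0F ◂ x) 0 w e
no-factor-at-0 f11   (() , _)
no-factor-at-0 f1001 (() , _)

-- State c stands for 00x, but the transition b ─γ→ c desubstitutes to 100x.
back : State → Word
back a = []
back b = 0F ∷ []
back c = 1F ∷ 0F ∷ 0F ∷ []
back d = 1F ∷ []

-- A 0 put in front completes the lone letter `comp l` to the block δ(l).
Bad-◂-δ⁻¹ : ∀ l y {n} → Bad (comp l ◂ δω y) (5 + n) → Bad (l ◂ y) (3 + n)
Bad-◂-δ⁻¹ l y {n} B = Bad-δ⁻¹ (3 + n) (+-monoʳ-≤ 6 (m≤m*n n 2)) (Bad-cong (λ i → sym (δω-◂ l y i)) (Bad-◂ 0F B))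

-- As 00 = δ(1), desubstitution leads to 01y. The leading 0 is then removed by descending once more,
-- from 01y = δω(0z) to 0z, and returning through `Bad-shift`, whose result starts with the second
-- letter of the block 01. Rounding up the half `k` costs one unit of the bound.
Bad-100δ⁻¹ : ∀ y z → δω z ≗ y → ∀ {n} → Bad (1F ◂ 0F ◂ 0F ◂ δω y) (5 + n) → Bad (1F ◂ y) (4 + n)
Bad-100δ⁻¹ y z eq {n} B with k , 3+n≤ , ≤4+n ← ≤-halves (3 + n) =
  Bad-mono ≤4+n (Bad-cong (◂-cong 1F eq) (Bad-shift 0F no-factor-at-0
    (Bad-δ⁻¹ k 3+n≤ (Bad-cong unfold (Bad-◂-δ⁻¹ 0F (1F ◂ y) (Bad-cong unfold′ B))))))
  where
  unfold : 0F ◂ 1F ◂ y ≗ δω (0F ◂ z)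
  unfold 0             = refl
  unfold 1             = refl
  unfold (suc (suc i)) = sym (eq i)
  unfold′ : 1F ◂ 0F ◂ 0F ◂ δω y ≗ 1F ◂ δω (1F ◂ y)
  unfold′ = ◂-cong 1F (λ i → sym (δω-◂ 1F y i))

-- Passing through 10y would not do: it starts with the factor 1001, which is no
-- trace of anything forbidden in 0δω(0y).
Bad-0δ0⁻¹ : ∀ {y n} → y 0 ≡ 0F → y 1 ≡ 1F → Bad (0F ◂ δω (0F ◂ y)) (5 + n) → Bad (0F ◂ y) (3 + n)
Bad-0δ0⁻¹ {y} {n} y0 y1 B = from B
  where
  widen : 0F ◂ 0F ◂ δω (0F ◂ y) ≗ δω (1F ◂ 0F ◂ y)
  widen i = sym (δω-◂ 1F (0F ◂ y) i)
  from-11 : Has11 (1F ◂ 0F ◂ y) (3 + n) → Bad (0F ◂ y) (3 + n)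
  from-11 (suc i , h) = Bad-mono (n≤1+n _) (factor f11 i (Literal-tail {1F} {0F ◂ y} p11 h))
  from : Bad (0F ◂ δω (0F ◂ y)) (5 + n) → Bad (0F ◂ y) (3 + n)
  from (factor f i h) =
    ⊥-elim (δω-no-factor {1F ◂ 0F ◂ y} f (Literal-map 1 (λ j → widen (suc j)) (λ _ → s≤s) _ h))
  from (encounter {p} f (suc i) (U , len , pos , h)) =
    Bad-δ⁻¹ {0F ◂ y} (3 + n) (≤-trans (n≤1+n _) (≤-trans (n≤1+n _) (+-monoʳ-≤ 6 (m≤m*n n 2))))
      (encounter f i (U , len , pos , Occ-tail {0F} p h))
  -- Read in δω(10y) the occurrence starts at the odd index 1, which excludes 1AA1. A pattern
  -- occurrence at index 0 of 10y makes the prefix 1001 recur, this time inside 0y.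
  from (encounter {p} f zero (U , len , pos , h))
    with desubstitute {1F ◂ 0F ◂ y} {p} {0} {1} {0} {6 + n} {3 + n} f z≤n refl (+-monoʳ-≤ 6 (m≤m*n n 2))
           (U , len , pos , Occ-map 1 (λ j → widen (suc j)) (λ _ → s≤s) p h)
  ... | inj₂ (inj₁ h11) = from-11 h11
  ... | inj₁ o with i , h′ ← 1001-recurs {1F ◂ 0F ◂ y} refl refl y0 y1 f o =
    Bad-mono (n≤1+n _) (factor f1001 i (Literal-tail {1F} {0F ◂ y} p1001 h′))

-- Halving brings the bound down to `3 + n`; the spare unit pays for the 1 put in front on `aγc` and
-- `dβc`, and for the rounding in `Bad-100δ⁻¹`.
Bad-step : ∀ {q o q′} n z → z 0 ≡ 0F → q ─[ o ]→ q′ →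
           Bad (back q ▹ δω (zeros o ▹ δω z)) (5 + n) → Bad (back q′ ▹ δω z) (4 + n)
Bad-step n z z0 aαa B = Bad-mono (n≤1+n _) (Bad-δ⁻¹ (3 + n) (≤-trans (n≤1+n _) (+-monoʳ-≤ 6 (m≤m*n n 2))) B)
Bad-step n z z0 aβb B = Bad-mono (n≤1+n _) (Bad-δ⁻¹ (3 + n) (≤-trans (n≤1+n _) (+-monoʳ-≤ 6 (m≤m*n n 2))) B)
Bad-step n z z0 aγc B = Bad-◂ 1F (Bad-δ⁻¹ (3 + n) (≤-trans (n≤1+n _) (+-monoʳ-≤ 6 (m≤m*n n 2))) B)
Bad-step n z z0 bβb B = Bad-mono (n≤1+n _) (Bad-0δ0⁻¹ refl (cong comp z0) B)
Bad-step n z z0 bαd B = Bad-mono (n≤1+n _) (Bad-◂-δ⁻¹ 1F _ B)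
Bad-step n z z0 bγc B = Bad-mono (n≤1+n _) (Bad-◂-δ⁻¹ 1F _ B)
Bad-step n z z0 cγc B = Bad-100δ⁻¹ (0F ◂ 0F ◂ δω z) (1F ◂ z) (δω-◂ 1F z) B
Bad-step n z z0 cαd B = Bad-100δ⁻¹ (δω z) z (λ _ → refl) B
Bad-step n z z0 dαb B = Bad-mono (n≤1+n _) (Bad-◂-δ⁻¹ 0F _ B)
Bad-step n z z0 dβc B = Bad-◂ 1F (Bad-◂-δ⁻¹ 0F _ B)

-- Zeros at every other index exclude 11 and 1001. Both patterns start with a cube and continue
-- after it, so within four letters the cube can only be a tripled letter at index 0.
four-letters-free : ∀ {x} → (x 0 ≡ 0F × x 2 ≡ 0F) ⊎ (x 1 ≡ 0F × x 3 ≡ 0F) →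
                    ¬ (x 0 ≡ x 1 × x 1 ≡ x 2) → ¬ Bad x 4
four-letters-free {x} z ncube = none z
  where
  none : (x 0 ≡ 0F × x 2 ≡ 0F) ⊎ (x 1 ≡ 0F × x 3 ≡ 0F) → ¬ Bad x 4
  none (inj₁ (z₀ , _)) (factor f11 0 (q , _))        = 0≢1 z₀ q
  none (inj₁ (_ , z₂)) (factor f11 1 (_ , q , _))    = 0≢1 z₂ q
  none (inj₁ (_ , z₂)) (factor f11 2 (q , _))        = 0≢1 z₂ q
  none (inj₂ (z₁ , _)) (factor f11 0 (_ , q , _))    = 0≢1 z₁ q
  none (inj₂ (z₁ , _)) (factor f11 1 (q , _))        = 0≢1 z₁ q
  none (inj₂ (_ , z₃)) (factor f11 2 (_ , q , _))    = 0≢1 z₃ q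
  none _ (factor f11 (suc (suc (suc i))) (_ , _ , s≤s (s≤s (s≤s (s≤s ())))))
  none (inj₁ (z₀ , _)) (factor f1001 0 (q , _))             = 0≢1 z₀ q
  none (inj₂ (_ , z₃)) (factor f1001 0 (_ , _ , _ , q , _)) = 0≢1 z₃ q
  none _ (factor f1001 (suc i) (_ , _ , _ , _ , s≤s (s≤s (s≤s (s≤s ())))))
  none _ (encounter f i o) = cubes f o
    where
    cube : ∀ n {u : ℕ → Letter} {i} → 0 < n → (∀ t → t < n → x (t + i) ≡ u t) →
           (∀ t → t < n → x (t + (n + i)) ≡ u t) → (∀ t → t < n → x (t + (n + (n + i))) ≡ u t) →
           ¬ (n + (n + (n + i)) < 4)
    cube 1 {i = zero} _ b₁ b₂ b₃ _ =
      ncube (trans (b₁ 0 z<s) (sym (b₂ 0 z<s)) , trans (b₂ 0 z<s) (sym (b₃ 0 z<s)))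
    cube 1 {i = suc i} _ b₁ b₂ b₃ (s≤s (s≤s (s≤s (s≤s ()))))
    cube n@(suc (suc _)) {i = i} _ b₁ b₂ b₃ end = <⇒≱ end
      (+-mono-≤ {2} {n} (s≤s (s≤s z≤n)) (≤-trans (s≤s (s≤s z≤n)) (m≤m+n n (n + i))))
    cubes : ∀ {p i} → ForbiddenPattern p → ¬ Occurs x p i 4
    cubes f0000 (U , len , pos , b₁ , b₂ , b₃ , b₄ , end) =
      cube (len 0F) (pos 0F) b₁ b₂ b₃ (≤-trans (+-monoˡ-≤ _ (pos 0F)) end)
    cubes f00010100 (U , len , pos , b₁ , b₂ , b₃ , b₄ , rest) =
      cube (len 0F) (pos 0F) b₁ b₂ b₃
        (≤-trans (+-monoˡ-≤ _ (pos 1F)) (Occ-end x U len (0F ∷ 1F ∷ 0F ∷ 0F ∷ []) rest))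

back-free : ∀ q z → z 0 ≡ 0F → ¬ Bad (back q ▹ δω z) 4
back-free a z z0 = four-letters-free (inj₁ (refl , refl)) (λ (q , _) → 0≢1 refl (trans q (cong comp z0)))
back-free b z z0 = four-letters-free (inj₂ (refl , refl)) (λ (_ , q) → 0≢1 refl (trans q (cong comp z0)))
back-free c z z0 = four-letters-free (inj₂ (refl , refl)) (λ ())
back-free d z z0 = four-letters-free (inj₂ (refl , refl)) (λ ())

-- Desubstitution of good words

BadFree : InfWord → Set
BadFree x = ∀ e → ¬ Bad x e

BadFree-cong : ∀ {x y} → x ≗ y → BadFree x → BadFree y
BadFree-cong eq F e B = F e (Bad-cong (λ i → sym (eq i)) B)

BadFree-tail : ∀ l {x} → BadFree (l ◂ x) → BadFree x
BadFree-tail l F e B = F (suc e) (Bad-◂ l B)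

BadFree-δ⁻¹ : ∀ {x} → BadFree (δω x) → BadFree x
BadFree-δ⁻¹ F e B = F (e * 2) (Bad-δ B)

BadFree-shift : ∀ l {x} → (∀ {w e} → ForbiddenFactor w → ¬ Literal (l ◂ x) 0 w e) →
                BadFree (comp l ◂ δω x) → BadFree (l ◂ x)
BadFree-shift l no F e B = F (e * 2) (Bad-shift l no B)

BadFree-drop : ∀ i {x} → BadFree x → BadFree (drop i x)
BadFree-drop i F e B = F (i + e) (Bad-map i (λ _ → refl) (λ _ → +-monoʳ-≤ i) B)

-- For the distance to the next 1, avoiding 11 excludes 1, avoiding 1001 excludes 3, and avoiding
-- 0000 excludes everything above 4.
next-one : ∀ {x} → BadFree x → x 1 ≡ 1F →
           x 2 ≡ 0F × (x 3 ≡ 1F ⊎ (x 4 ≡ 0F × x 5 ≡ 1F))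
next-one {x} F x1 with x 2 in x2
... | 1F = ⊥-elim (F 3 (factor f11 1 (x1 , x2 , ≤-refl)))
... | 0F with x 3 in x3
...   | 1F = refl , inj₁ refl
...   | 0F with x 4 in x4
...     | 1F = ⊥-elim (F 5 (factor f1001 1 (x1 , x2 , x3 , x4 , ≤-refl)))
...     | 0F with x 5 in x5
...       | 1F = refl , inj₂ (refl , refl)
...       | 0F = ⊥-elim (F 6 (encounter f0000 2 (literal-occurs x _ (x2 , x3 , x4 , x5 , ≤-refl))))

-- The next 1 stands at index 3 or 5, so dropping two or four letters leaves a word that again
-- begins with 01.
BadFree-even-zero : ∀ {x} → BadFree x → x 0 ≡ 0F → x 1 ≡ 1F → ∀ k → x (k * 2) ≡ 0F
BadFree-even-zero F x0 x1 0 = x0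
BadFree-even-zero F x0 x1 1 = proj₁ (next-one F x1)
BadFree-even-zero F x0 x1 (suc (suc k)) = [
    (λ x3 → BadFree-even-zero (BadFree-drop 2 F) (proj₁ (next-one F x1)) x3 (suc k)) ,
    (λ (x4 , x5) → BadFree-even-zero (BadFree-drop 4 F) x4 x5 k) ]′ (proj₂ (next-one F x1))

leading-zeros : ∀ {x} → BadFree x → x 0 ≡ 0F →
                ∃[ o ] ∃[ y ] (y 0 ≡ 0F × y 1 ≡ 1F × x ≗ zeros o ▹ y)
leading-zeros {x} F x0 with x 1 in x1
... | 1F = α , x , x0 , x1 , λ _ → refl
... | 0F with x 2 in x2
...   | 1F = β , drop 1 x , x1 , x2 , λ { zero → x0 ; (suc _) → refl }
...   | 0F with x 3 in x3
...     | 1F = γ , drop 2 x , x2 , x3 , λ { 0 → x0 ; 1 → x1 ; (suc (suc _)) → refl }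
...     | 0F = ⊥-elim (F 4 (encounter f0000 0 (literal-occurs x _ (x0 , x1 , x2 , x3 , ≤-refl))))

-- The prefix under which a good word is known to stay good. State c has 00 here, in contrast to the
-- 100 of `back`: goodness of 00x is what the transitions leaving c consume.
front : State → Word
front a = []
front b = 0F ∷ []
front c = 0F ∷ 0F ∷ []
front d = 1F ∷ []

no-factor-at-1 : ∀ {x w e} → x 0 ≡ 0F → x 1 ≡ 1F → ForbiddenFactor w → ¬ Literal (1F ◂ x) 0 w e
no-factor-at-1 x0 x1 f11   (_ , q , _)     = 0≢1 x0 q
no-factor-at-1 x0 x1 f1001 (_ , _ , q , _) = 0≢1 q x1

BadFree-step : ∀ q o {y} → y 0 ≡ 0F → y 1 ≡ 1F → BadFree (front q ▹ δω (zeros o ▹ y)) →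
               ∃[ q′ ] (q ─[ o ]→ q′ × BadFree (front q′ ▹ y))
BadFree-step a α y0 y1 F = a , aαa , BadFree-δ⁻¹ F
BadFree-step a β y0 y1 F = b , aβb , BadFree-δ⁻¹ F
BadFree-step a γ y0 y1 F = c , aγc , BadFree-δ⁻¹ F
BadFree-step b α y0 y1 F = d , bαd , BadFree-shift 1F (no-factor-at-1 y0 y1) F
BadFree-step b β y0 y1 F = b , bβb , BadFree-δ⁻¹ (BadFree-tail 0F F)
BadFree-step b γ y0 y1 F = c , bγc , BadFree-δ⁻¹ (BadFree-tail 0F F)
BadFree-step c α y0 y1 F = d , cαd , BadFree-shift 1F (no-factor-at-1 y0 y1) (BadFree-tail 0F F)
-- 00δω(0y) = δω(10y), and 10y begins with 1001.
BadFree-step c β {y} y0 y1 F =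
  ⊥-elim (BadFree-δ⁻¹ (BadFree-cong (λ i → sym (δω-◂ 1F (0F ◂ y) i)) F) 4
    (factor f1001 0 (refl , refl , y0 , y1 , ≤-refl)))
BadFree-step c γ y0 y1 F = c , cγc , BadFree-δ⁻¹ (BadFree-tail 0F (BadFree-tail 0F F))
BadFree-step d α y0 y1 F = b , dαb , BadFree-shift 0F no-factor-at-0 F
BadFree-step d β y0 y1 F = c , dβc , BadFree-shift 0F no-factor-at-0 F
-- `BadFree-shift` would make 000y good, but it begins with 0000.
BadFree-step d γ {y} y0 y1 F =
  ⊥-elim (BadFree-shift 0F no-factor-at-0 F 4
    (encounter f0000 0 (literal-occurs (0F ◂ 0F ◂ 0F ◂ y) _ (refl , refl , refl , y0 , ≤-refl))))

-- Conversion between words as lists and indexed occurrences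

prefix-cong : ∀ w {x y} → x ≗ y → w isPrefixOf x → w isPrefixOf y
prefix-cong []      eq h = refl
prefix-cong (l ∷ w) eq h with h₀ , h′ ← ∷-injective h =
  cong₂ _∷_ (trans (sym (eq 0)) h₀) (prefix-cong w (eq ∘ suc) h′)

Literal⇒prefix : ∀ w {x y i e} → (∀ j → y j ≡ x (j + i)) → Literal x i w e → w isPrefixOf y
Literal⇒prefix []      eq h = refl
Literal⇒prefix (l ∷ w) {x} {i = i} eq (q , h) = cong₂ _∷_ (trans (eq 0) q)
  (Literal⇒prefix w (λ j → trans (eq (suc j)) (cong x (sym (+-suc j i)))) h)

prefix⇒Literal : ∀ w {x y i} → (∀ j → y j ≡ x (j + i)) → w isPrefixOf y → Literal x i w (length w + i)
prefix⇒Literal []      eq h = ≤-refl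
prefix⇒Literal (l ∷ w) {x} {i = i} eq h with h₀ , h′ ← ∷-injective h =
  trans (sym (eq 0)) h₀ ,
  subst (Literal x (suc i) w) (+-suc (length w) i)
    (prefix⇒Literal w (λ j → trans (eq (suc j)) (cong x (sym (+-suc j i)))) h′)

isFactorOf⇒Literal : ∀ w {x} → w isFactorOf x → ∃[ i ] Literal x i w (length w + i)
isFactorOf⇒Literal w {x} (i , h) = i , prefix⇒Literal w (λ j → cong x (+-comm i j)) h

Literal⇒isFactorOf : ∀ x w {i e} → Literal x i w e → w isFactorOf x
Literal⇒isFactorOf x w {i} h = i , Literal⇒prefix w (λ j → cong x (+-comm i j)) h

at : Word → ℕ → Letter
-- A default value outside the word; blocks are compared at indices below the length only.
at []      _       = 0F
at (l ∷ w) zero    = l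
at (l ∷ w) (suc n) = at w n

Literal-++⁻ : ∀ x u v {i e} → Literal x i (u ++ v) e →
              (∀ t → t < length u → x (t + i) ≡ at u t) × Literal x (length u + i) v e
Literal-++⁻ x []      v h       = (λ _ ()) , h
Literal-++⁻ x (l ∷ u) v {i} {e} (q , h) with block , h′ ← Literal-++⁻ x u v h =
  (λ { zero _ → q ; (suc t) t< → trans (cong x (sym (+-suc t i))) (block t (s≤s⁻¹ t<)) }) ,
  subst (λ j → Literal x j v e) (+-suc (length u) i) h′

Literal-++⁺ : ∀ x n {U : ℕ → Letter} v {i e} → (∀ t → t < n → x (t + i) ≡ U t) →
              Literal x (n + i) v e → Literal x i (applyUpTo U n ++ v) e
Literal-++⁺ x zero    v block h = h
Literal-++⁺ x (suc n) v {i} {e} block h = block 0 z<s ,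
  Literal-++⁺ x n v (λ t t< → trans (cong x (+-suc t i)) (block (suc t) (s<s t<)))
    (subst (λ j → Literal x j v e) (sym (+-suc n i)) h)

Literal⇒Occ : ∀ x g p {i e} → Literal x i (concatMap g p) e → Occ x (at ∘ g) (length ∘ g) i p e
Literal⇒Occ x g []      h = h
Literal⇒Occ x g (l ∷ p) h with block , h′ ← Literal-++⁻ x (g l) (concatMap g p) h =
  block , Literal⇒Occ x g p h′

Occ⇒Literal : ∀ x U len p {i e} → Occ x U len i p e →
              Literal x i (concatMap (λ l → applyUpTo (U l) (len l)) p) e
Occ⇒Literal x U len []      h           = h
Occ⇒Literal x U len (l ∷ p) (block , h) = Literal-++⁺ x (len l) _ block (Occ⇒Literal x U len p h)

Encounters⇒Occurs : ∀ {x p} → Encounters x p → ∃[ i ] ∃[ e ] Occurs x p i e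
Encounters⇒Occurs {x} {p} (g , nonerasing , h) with i , lit ← isFactorOf⇒Literal (concatMap g p) h =
  i , _ , at ∘ g , length ∘ g , (λ l → positive (g l) (nonerasing l)) , Literal⇒Occ x g p lit
  where
  positive : ∀ w → w ≢ [] → 0 < length w
  positive []      ne = ⊥-elim (ne refl)
  positive (_ ∷ _) _  = z<s

Occurs⇒Encounters : ∀ x p {i e} → Occurs x p i e → Encounters x p
Occurs⇒Encounters x p (U , len , pos , h) =
  (λ l → applyUpTo (U l) (len l)) , (λ l → nonempty (len l) (pos l)) ,
  Literal⇒isFactorOf x _ (Occ⇒Literal x U len p h)
  where
  nonempty : ∀ n {u : ℕ → Letter} → 0 < n → applyUpTo u n ≢ []
  nonempty (suc n) _ ()

Good⇒BadFree : ∀ {x} → Good x → BadFree x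
Good⇒BadFree {x} G e (factor f11 i h)           = Good.no-11 G (Literal⇒isFactorOf x _ h)
Good⇒BadFree {x} G e (factor f1001 i h)         = Good.no-1001 G (Literal⇒isFactorOf x _ h)
Good⇒BadFree {x} G e (encounter f0000 i o)      = Good.avoids-0000 G (Occurs⇒Encounters x _ o)
Good⇒BadFree {x} G e (encounter f00010100 i o)  = Good.avoids-00010100 G (Occurs⇒Encounters x _ o)

BadFree⇒Good : ∀ {x} → BadFree x → Good x
BadFree⇒Good {x} F = record
  { no-11           = no-factor f11
  ; no-1001         = no-factor f1001
  ; avoids-0000     = no-pattern f0000
  ; avoids-00010100 = no-pattern f00010100
  }
  where
  no-factor : ∀ {w} → ForbiddenFactor w → ¬ w isFactorOf x
  no-factor f h with i , lit ← isFactorOf⇒Literal _ h = F _ (factor f i lit)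
  no-pattern : ∀ {p} → ForbiddenPattern p → ¬ Encounters x p
  no-pattern f h with i , e , o ← Encounters⇒Occurs h = F e (encounter f i o)

-- Iterates of the operators on 01

iterates : (ℕ → Op) → ℕ → Word
iterates f zero    = w01
iterates f (suc n) = iterates f n ++ δ^ n (ext (f n))

-- `iterates` adds the last operator at the right end, whereas desubstitution consumes the first
-- one. Since δ maps each appended word to the one appended a level higher, all reduces to 01
-- `ext o` = δ(`zeros o` 01).
iterates-suc : ∀ n f → iterates f (suc n) ≡ concatMap δ (zeros (f 0) ++ iterates (f ∘ suc) n)
iterates-suc zero f with f 0
... | α = refl
... | β = refl
... | γ = refl
iterates-suc (suc n) f = begin
  iterates f (suc n) ++ δ^ (suc n) (ext (f (suc n)))
    ≡⟨ cong (_++ δ^ (suc n) (ext (f (suc n)))) (iterates-suc n f) ⟩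
  concatMap δ (zeros (f 0) ++ iterates (f ∘ suc) n) ++ concatMap δ (δ^ n (ext (f (suc n))))
    ≡⟨ concatMap-++ δ (zeros (f 0) ++ iterates (f ∘ suc) n) _ ⟨
  concatMap δ ((zeros (f 0) ++ iterates (f ∘ suc) n) ++ δ^ n (ext (f (suc n))))
    ≡⟨ cong (concatMap δ) (++-assoc (zeros (f 0)) _ _) ⟩
  concatMap δ (zeros (f 0) ++ iterates (f ∘ suc) (suc n)) ∎
  where open ≡-Reasoning

iterates-suffix : ∀ n f → δ^ n w01 isSuffixOf iterates f n
iterates-suffix zero    f = [] , refl
iterates-suffix (suc n) f with y , eq ← iterates-suffix n (f ∘ suc) =
  concatMap δ (zeros (f 0) ++ y) , (begin
  iterates f (suc n)                                       ≡⟨ iterates-suc n f ⟩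
  concatMap δ (zeros (f 0) ++ iterates (f ∘ suc) n)        ≡⟨ cong (λ w → concatMap δ (zeros (f 0) ++ w)) eq ⟩
  concatMap δ (zeros (f 0) ++ (y ++ δ^ n w01))             ≡⟨ cong (concatMap δ) (++-assoc (zeros (f 0)) y _) ⟨
  concatMap δ ((zeros (f 0) ++ y) ++ δ^ n w01)             ≡⟨ concatMap-++ δ (zeros (f 0) ++ y) _ ⟩
  concatMap δ (zeros (f 0) ++ y) ++ δ^ (suc n) w01         ∎)
  where open ≡-Reasoning

length-concatMap-δ : ∀ w → length (concatMap δ w) ≡ 2 * length w
length-concatMap-δ []       = refl
length-concatMap-δ (0F ∷ w) = trans (cong (2 +_) (length-concatMap-δ w)) (sym (*-suc 2 (length w)))
length-concatMap-δ (1F ∷ w) = trans (cong (2 +_) (length-concatMap-δ w)) (sym (*-suc 2 (length w)))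

length-δ^ : ∀ n w → length (δ^ n w) ≡ 2 ^ n * length w
length-δ^ zero    w = sym (+-identityʳ _)
length-δ^ (suc n) w = trans (length-concatMap-δ (δ^ n w))
  (trans (cong (2 *_) (length-δ^ n w)) (sym (*-assoc 2 (2 ^ n) (length w))))

-- The extreme case is γ throughout, of length 2 + 6(2ⁿ - 1); the 4 stands on the left to avoid
-- subtraction.
length-iterates-≤ : ∀ n f → length (iterates f n) + 4 ≤ 2 ^ n * 6
length-iterates-≤ zero    f = ≤-refl
length-iterates-≤ (suc n) f = begin
  length (iterates f (suc n)) + 4                              ≡⟨ cong (_+ 4) (length-++ (iterates f n)) ⟩
  length (iterates f n) + length (δ^ n (ext (f n))) + 4        ≡⟨ arith (length (iterates f n)) _ ⟩
  length (iterates f n) + 4 + length (δ^ n (ext (f n)))        ≡⟨ cong (length (iterates f n) + 4 +_) (length-δ^ n (ext (f n))) ⟩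
  length (iterates f n) + 4 + 2 ^ n * length (ext (f n))       ≤⟨ +-mono-≤ (length-iterates-≤ n f) (*-monoʳ-≤ (2 ^ n) (length-ext (f n))) ⟩
  2 ^ n * 6 + 2 ^ n * 6                                        ≡⟨ arith′ (2 ^ n) ⟩
  2 ^ suc n * 6                                                ∎
  where
  open ≤-Reasoning
  arith : ∀ m n → m + n + 4 ≡ m + 4 + n
  arith = solve-∀
  arith′ : ∀ m → m * 6 + m * 6 ≡ 2 * m * 6
  arith′ = solve-∀
  length-ext : ∀ o → length (ext o) ≤ 6
  length-ext α = m≤n+m 2 4
  length-ext β = m≤n+m 4 2
  length-ext γ = ≤-refl

length-iterates-> : ∀ n f → n < length (iterates f n)
length-iterates-> zero    f = z<s
length-iterates-> (suc n) f = begin-strict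
  suc n                                            <⟨ +-mono-≤-< {1} (≤-trans (s≤s z≤n) ih) ih ⟩
  length w + length w                              ≡⟨ cong (length w +_) (+-identityʳ _) ⟨
  2 * length w                                     ≤⟨ *-monoʳ-≤ 2 w≤ ⟩
  2 * length (zeros (f 0) ++ w)                    ≡⟨ length-concatMap-δ (zeros (f 0) ++ w) ⟨
  length (concatMap δ (zeros (f 0) ++ w))          ≡⟨ cong length (iterates-suc n f) ⟨
  length (iterates f (suc n))                      ∎
  where
  open ≤-Reasoning
  w = iterates (f ∘ suc) n
  w≤ : length w ≤ length (zeros (f 0) ++ w)
  w≤ = ≤-trans (m≤n+m _ (length (zeros (f 0)))) (≤-reflexive (sym (length-++ (zeros (f 0)))))
  ih : n < length w
  ih = length-iterates-> n (f ∘ suc)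

EndsIn : Word → Letter → Set
EndsIn w l = ∃[ u ] w ≡ u ++ l ∷ []

EndsIn-unique : ∀ {w l k} → EndsIn w l → EndsIn w k → l ≡ k
EndsIn-unique (u , p) (v , q) = ∷ʳ-injectiveʳ u v (trans (sym p) q)

EndsIn-++ : ∀ u {w l} → EndsIn w l → EndsIn (u ++ w) l
EndsIn-++ u (v , p) = u ++ v , trans (cong (u ++_) p) (sym (++-assoc u v _))

EndsIn-δ : ∀ {w l} → EndsIn w l → EndsIn (concatMap δ w) (comp l)
EndsIn-δ {w} {l} (u , p) = concatMap δ u ++ 0F ∷ [] , trans (cong (concatMap δ) p)
  (trans (concatMap-++ δ u (l ∷ [])) (trans (cong (concatMap δ u ++_) (δ-letter l))
    (sym (++-assoc (concatMap δ u) _ _))))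
  where
  δ-letter : ∀ l → concatMap δ (l ∷ []) ≡ 0F ∷ comp l ∷ []
  δ-letter 0F = refl
  δ-letter 1F = refl

last-letter : ℕ → Letter
last-letter zero    = 1F
last-letter (suc n) = comp (last-letter n)

δ^-EndsIn : ∀ n → EndsIn (δ^ n w01) (last-letter n)
δ^-EndsIn zero    = 0F ∷ [] , refl
δ^-EndsIn (suc n) = EndsIn-δ (δ^-EndsIn n)

l≢comp[l] : ∀ l → l ≢ comp l
l≢comp[l] 0F ()
l≢comp[l] 1F ()

-- Level n + 1 is excluded by the last letter and higher levels by length.
iterates-MaxLevel : ∀ n f → MaxLevel (iterates f n) n
iterates-MaxLevel n f = iterates-suffix n f , maximal
  where
  open ≤-Reasoning
  too-long : ∀ m → δ^ m w01 isSuffixOf iterates f n → m < 2 + n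
  too-long m (y , eq) = ≰⇒> λ 2+n≤m → <-irrefl refl (begin-strict
    2 ^ n * 8                          ≡⟨ arith (2 ^ n) ⟨
    2 ^ (2 + n) * 2                    ≤⟨ *-monoˡ-≤ 2 (^-monoʳ-≤ 2 2+n≤m) ⟩
    2 ^ m * 2                          ≡⟨ length-δ^ m w01 ⟨
    length (δ^ m w01)                  ≤⟨ m≤n+m _ (length y) ⟩
    length y + length (δ^ m w01)       ≡⟨ length-++ y ⟨
    length (y ++ δ^ m w01)             ≡⟨ cong length eq ⟨
    length (iterates f n)              <⟨ m<m+n _ {4} z<s ⟩
    length (iterates f n) + 4          ≤⟨ length-iterates-≤ n f ⟩
    2 ^ n * 6                          ≤⟨ *-monoʳ-≤ (2 ^ n) (m≤n+m 6 2) ⟩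
    2 ^ n * 8                          ∎)
    where
    arith : ∀ k → 2 * (2 * k) * 2 ≡ k * 8
    arith = solve-∀
  maximal : ∀ m → δ^ m w01 isSuffixOf iterates f n → m ≤ n
  maximal m s with <-cmp m (suc n)
  ... | tri< m<1+n _ _ = s≤s⁻¹ m<1+n
  ... | tri> _ _ m>1+n = ⊥-elim (<⇒≱ m>1+n (s≤s⁻¹ (too-long m s)))
  ... | tri≈ _ refl _ with y , eq ← s | z , eq′ ← iterates-suffix n f =
    ⊥-elim (l≢comp[l] (last-letter n) (EndsIn-unique
      (subst (λ w → EndsIn w (last-letter n)) (sym eq′) (EndsIn-++ z (δ^-EndsIn n)))
      (subst (λ w → EndsIn w (last-letter (suc n))) (sym eq) (EndsIn-++ y (δ^-EndsIn (suc n))))))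

-- Infinite words having all iterates as prefixes

Prefixes : (ℕ → Op) → InfWord → Set
Prefixes f x = ∀ n → iterates f n isPrefixOf x

-- The level chosen in step `n` is maximal, and so is `n`; hence they agree and the chain `W`
-- consists of the iterates.
•⇒Prefixes : ∀ {x f} → w01 isPrefixOf x → x ≐ w01 • f → Prefixes f x
•⇒Prefixes     h R zero    = h
•⇒Prefixes {x} {f} h R (suc n) = subst (_isPrefixOf x) (W≡ (suc n)) (prefixes n)
  where
  open _≐_•_ R
  W≡ : ∀ n → W n ≡ iterates f n
  W≡ zero = start
  W≡ (suc n) with m , (suffix , maximal) , eq ← step n =
    trans eq (cong₂ (λ w k → w ++ δ^ k (ext (f n))) (W≡ n) (≤-antisym
      (proj₂ (iterates-MaxLevel n f) m (subst (δ^ m w01 isSuffixOf_) (W≡ n) suffix))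
      (maximal n (subst (δ^ n w01 isSuffixOf_) (sym (W≡ n)) (iterates-suffix n f)))))

Prefixes⇒• : ∀ {x f} → Prefixes f x → x ≐ w01 • f
Prefixes⇒• {f = f} P = record
  { W        = iterates f
  ; start    = refl
  ; step     = λ n → n , iterates-MaxLevel n f , refl
  ; prefixes = λ n → P (suc n)
  }

prefix-δ : ∀ w {x} → w isPrefixOf x → concatMap δ w isPrefixOf δω x
prefix-δ [] h = refl
prefix-δ (0F ∷ w) h with h₀ , h′ ← ∷-injective h = cong₂ (λ l v → 0F ∷ l ∷ v) (cong comp h₀) (prefix-δ w h′)
prefix-δ (1F ∷ w) h with h₀ , h′ ← ∷-injective h = cong₂ (λ l v → 0F ∷ l ∷ v) (cong comp h₀) (prefix-δ w h′)

prefix-▹ : ∀ u {w x} → w isPrefixOf x → (u ++ w) isPrefixOf (u ▹ x)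
prefix-▹ []      h = h
prefix-▹ (l ∷ u) h = cong (l ∷_) (prefix-▹ u h)

prefix-δ⁻¹ : ∀ w {x} → concatMap δ w isPrefixOf x →
             (∀ k → k < length w → x (k * 2) ≡ 0F) × w isPrefixOf δ⁻¹ω x
prefix-δ⁻¹ [] h = (λ _ ()) , refl
prefix-δ⁻¹ (0F ∷ w) h
  with h₀ , h′ ← ∷-injective h with h₁ , h″ ← ∷-injective h′ with evens , p ← prefix-δ⁻¹ w h″ =
  (λ { zero _ → h₀ ; (suc k) k< → evens k (s≤s⁻¹ k<) }) , cong₂ _∷_ (cong comp h₁) p
prefix-δ⁻¹ (1F ∷ w) h
  with h₀ , h′ ← ∷-injective h with h₁ , h″ ← ∷-injective h′ with evens , p ← prefix-δ⁻¹ w h″ =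
  (λ { zero _ → h₀ ; (suc k) k< → evens k (s≤s⁻¹ k<) }) , cong₂ _∷_ (cong comp h₁) p

prefix-++⁻ : ∀ u {v x} → (u ++ v) isPrefixOf x → x ≗ u ▹ drop (length u) x × v isPrefixOf drop (length u) x
prefix-++⁻ []      h = (λ _ → refl) , h
prefix-++⁻ (l ∷ u) h with h₀ , h′ ← ∷-injective h with eq , p ← prefix-++⁻ u h′ =
  (λ { zero → h₀ ; (suc n) → eq n }) , p

-- By `iterates-suc` arbitrarily long prefixes are images under δ; hence even indices carry 0, and
-- the preimage starts with the zeros of the first operator.
Prefixes-uncons : ∀ {f x} → Prefixes f x →
                  ∃[ y ] (x ≗ δω (zeros (f 0) ▹ y) × Prefixes (f ∘ suc) y)
Prefixes-uncons {f} {x} P =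
  drop (length u) (δ⁻¹ω x) ,
  (λ i → trans (δω-δ⁻¹ω {x} evens i) (δω-cong (proj₁ (prefix-++⁻ u (proj₂ (image 0)))) i)) ,
  λ n → proj₂ (prefix-++⁻ u (proj₂ (image n)))
  where
  u = zeros (f 0)
  image : ∀ n → (∀ k → k < length (u ++ iterates (f ∘ suc) n) → x (k * 2) ≡ 0F) ×
                (u ++ iterates (f ∘ suc) n) isPrefixOf δ⁻¹ω x
  image n = prefix-δ⁻¹ _ (subst (_isPrefixOf x) (iterates-suc n f) (P (suc n)))
  evens : ∀ k → x (k * 2) ≡ 0F
  evens k = proj₁ (image k) k (≤-trans (length-iterates-> k (f ∘ suc))
    (≤-trans (m≤n+m _ (length u)) (≤-reflexive (sym (length-++ u)))))

-- The two directions of the equivalence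

Prefixes⇒δω : ∀ {f x} → Prefixes f x → ∃[ z ] (z 0 ≡ 0F × x ≗ δω z)
Prefixes⇒δω {f} {x} P with y , eq , _ ← Prefixes-uncons P =
  zeros (f 0) ▹ y , trans (sym (comp-involutive _)) (cong comp (trans (sym (eq 1)) (∷-injectiveˡ (∷-injectiveʳ (P 0))))) , eq

-- Induction on the excess of the bound over four: each step passes to the rest of the path and to
-- the desubstituted word.
path⇒¬Bad : ∀ n {f x} (q : ℕ → State) → (∀ k → q k ─[ f k ]→ q (suc k)) → Prefixes f x →
            ¬ Bad (back (q 0) ▹ x) (4 + n)
path⇒¬Bad zero q path P B with z , z0 , eq ← Prefixes⇒δω P =
  back-free (q 0) z z0 (Bad-cong (▹-cong (back (q 0)) eq) B)
-- `Bad-step` asks for the remaining word as an image δω z with z starting with 0, hence a second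
-- desubstitution.
path⇒¬Bad (suc n) {f} q path P B with y , eq , P′ ← Prefixes-uncons P with z , z0 , eq′ ← Prefixes⇒δω P′ =
  path⇒¬Bad n (q ∘ suc) (path ∘ suc) P′ (Bad-cong (▹-cong (back (q 1)) (λ i → sym (eq′ i)))
    (Bad-step n z z0 (path 0) (Bad-cong (▹-cong (back (q 0))
      (λ i → trans (eq i) (δω-cong (▹-cong (zeros (f 0)) eq′) i))) B)))

record Config : Set where
  field
    state : State
    word  : InfWord
    word0 : word 0 ≡ 0F
    word1 : word 1 ≡ 1F
    free  : BadFree (front state ▹ word)

open Config

BadFree-▹ : ∀ u {x} → BadFree (u ▹ x) → BadFree x
BadFree-▹ []      F = F
BadFree-▹ (l ∷ u) F = BadFree-▹ u (BadFree-tail l F)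

next : ∀ s → ∃[ o ] ∃[ s′ ] (state s ─[ o ]→ state s′ × word s ≗ δω (zeros o ▹ word s′))
next s
  with δω-form ← δω-δ⁻¹ω (BadFree-even-zero (BadFree-▹ (front (state s)) (free s)) (word0 s) (word1 s))
  with o , y , y0 , y1 , eq ← leading-zeros
         (BadFree-δ⁻¹ (BadFree-cong δω-form (BadFree-▹ (front (state s)) (free s)))) (cong comp (word1 s))
  with word-eq ← (λ i → trans (δω-form i) (δω-cong eq i))
  with q′ , t , F ← BadFree-step (state s) o y0 y1 (BadFree-cong (▹-cong (front (state s)) word-eq) (free s)) =
  o , record { state = q′ ; word = y ; word0 = y0 ; word1 = y1 ; free = F } , t , word-eq

-- Peeling off the first step makes `labels s ∘ suc` by definition the labels of the next
-- configuration, as the induction in `labels-Prefixes` requires.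
run : Config → ℕ → Config
run s zero    = s
run s (suc n) = run (proj₁ (proj₂ (next s))) n

labels : Config → ℕ → Op
labels s n = proj₁ (next (run s n))

labels-path : ∀ s n → state (run s n) ─[ labels s n ]→ state (run s (suc n))
labels-path s zero    = proj₁ (proj₂ (proj₂ (next s)))
labels-path s (suc n) = labels-path (proj₁ (proj₂ (next s))) n

labels-Prefixes : ∀ s → Prefixes (labels s) (word s)
labels-Prefixes s zero    = cong₂ (λ l k → l ∷ k ∷ []) (word0 s) (word1 s)
labels-Prefixes s (suc n) = subst (_isPrefixOf word s) (sym (iterates-suc n (labels s)))
  (prefix-cong (concatMap δ w) (λ i → sym (proj₂ (proj₂ (proj₂ (next s))) i))
    (prefix-δ w (prefix-▹ (zeros (labels s 0)) (labels-Prefixes (proj₁ (proj₂ (next s))) n))))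
  where
  w = zeros (labels s 0) ++ iterates (labels s ∘ suc) n

theorem3p5 : (x : InfWord) → w01 isPrefixOf x → Good x ⇔ (∃[ f ] (F f × x ≐ w01 • f))
theorem3p5 x h = mk⇔ to from
  where
  to : Good x → ∃[ f ] (F f × x ≐ w01 • f)
  to G = labels s , (state ∘ run s , refl , labels-path s) , Prefixes⇒• (labels-Prefixes s)
    where
    s : Config
    s = record { state = a ; word = x ; word0 = ∷-injectiveˡ h
               ; word1 = ∷-injectiveˡ (∷-injectiveʳ h) ; free = Good⇒BadFree G }
  from : ∃[ f ] (F f × x ≐ w01 • f) → Good x
  from (f , (q , q0 , path) , R) = BadFree⇒Good λ e B →
    -- `back a` is empty, so this concerns x itself; the bound is raised by the 4 of the base case.
    path⇒¬Bad e q path (•⇒Prefixes h R)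
      (subst (λ r → Bad (back r ▹ x) (4 + e)) (sym q0) (Bad-mono (m≤n+m e 4) B))
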